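{- $t(3)=5$.
   Context: Let $\mathfrak{C}=\{0,1\}^n$ be the vertex set of the $n$-dimensional hypercube; $\oplus,\wedge$ denote bitwise XOR and AND. An outmap is any function $s:\mathfrak{C}\to\{0,1\}^n$. A clash of $s$ is a pair of distinct vertices $u,v$ with $(s(u)\oplus s(v))\wedge(u\oplus v)=0^n$. A query at $u$ to the oracle for $s$ returns $s(u)$; algorithms choose queries adaptively, and only the number of queries is counted. \textsc{Sink-or-Clash}: given oracle access to an arbitrary outmap $s$, query either a vertex $u$ with $s(u)=0^n$ or both vertices of some clash. $t(n)=\min_{\mathcal A}\max_s t(\mathcal A,s)$, where $\mathcal A$ ranges over deterministic algorithms solving \textsc{Sink-or-Clash} on all outmaps of the $n$-cube and $t(\mathcal A,s)$ is the number of queries made on $s$. -}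

module Defs where

open import Data.Bool.Base using (Bool; false; _∧_; _xor_)
open import Data.List.Base using (List; []; _∷_; length)
open import Data.List.Membership.Propositional using (_∈_)
open import Data.Nat.Base using (ℕ; _≤_)
open import Data.Product.Base using (∃; ∃₂; _×_)
open import Data.Sum.Base using (_⊎_)
open import Data.Vec.Base using (Vec; replicate; zipWith)
open import Relation.Binary.PropositionalEquality using (_≡_; _≢_)

Bits : ℕ → Set
Bits n = Vec Bool n

Vertex : ℕ → Set
Vertex = Bits

Outmap : ℕ → Set
Outmap n = Vertex n → Bits n

𝟎 : ∀ {n} → Bits n
𝟎 {n} = replicate n false

infixl 6 _⊕_
infixl 7 _⩕_

_⊕_ : ∀ {n} → Bits n → Bits n → Bits n
_⊕_ = zipWith _xor_

_⩕_ : ∀ {n} → Bits n → Bits n → Bits n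
_⩕_ = zipWith _∧_

Sink : ∀ {n} → Outmap n → Vertex n → Set
Sink s u = s u ≡ 𝟎

Clash : ∀ {n} → Outmap n → Vertex n → Vertex n → Set
Clash s u v = u ≢ v × (s u ⊕ s v) ⩕ (u ⊕ v) ≡ 𝟎

-- A deterministic adaptive algorithm, as a decision tree: the next query
-- (or the decision to stop) is a function of the oracle's earlier answers.
-- The tree is well-founded, so every run makes finitely many queries.
data Algorithm (n : ℕ) : Set where
  stop  : Algorithm n
  query : Vertex n → (Bits n → Algorithm n) → Algorithm n

queries : ∀ {n} → Algorithm n → Outmap n → List (Vertex n)
queries stop        s = []
queries (query u κ) s = u ∷ queries (κ (s u)) s

-- Repeated queries of one vertex are counted each time.
numQueries : ∀ {n} → Algorithm n → Outmap n → ℕ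
numQueries A s = length (queries A s)

SolvesOn : ∀ {n} → Algorithm n → Outmap n → Set
SolvesOn A s =
    (∃ λ u → u ∈ queries A s × Sink s u)
  ⊎ (∃₂ λ u v → u ∈ queries A s × v ∈ queries A s × Clash s u v)

SolvesSinkOrClash : ∀ {n} → Algorithm n → Set
SolvesSinkOrClash {n} A = (s : Outmap n) → SolvesOn A s

IsMax : (ℕ → Set) → ℕ → Set
IsMax P m = P m × (∀ k → P k → k ≤ m)

IsMin : (ℕ → Set) → ℕ → Set
IsMin P m = P m × (∀ k → P k → m ≤ k)

-- m = max_s t(A, s)
IsWorstCase : ∀ {n} → Algorithm n → ℕ → Set
IsWorstCase A = IsMax (λ q → ∃ λ s → numQueries A s ≡ q)

-- k = t(n).  The minimum ranges over an infinite class of algorithms, so t is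
-- given by its graph; IsMin determines k uniquely.
t[_]≡_ : ℕ → ℕ → Set
t[ n ]≡ k = IsMin (λ m → ∃ λ (A : Algorithm n) → SolvesSinkOrClash A × IsWorstCase A m) k

{-# OPTIONS --safe #-}

-- Sink-or-Clash is a finite game between the algorithm, choosing vertices, and
-- an evader, choosing outmap values.  The algorithm can force a win within k
-- rounds iff some algorithm always succeeds with at most k queries, and whether
-- it can is decidable, so the 3-cube is settled by evaluating the game tree.

module Submission where

open import Defs
open import Data.Bool.Base using (true; false; _∧_; if_then_else_)
import Data.Bool.Properties as Bool
open import Data.Empty using (⊥)
open import Data.List.Base using (List; []; _∷_; map; _ʳ++_)
open import Data.List.Membership.Propositional using (_∈_)
open import Data.List.Relation.Unary.All as All using (All; []; _∷_)
open import Data.List.Relation.Unary.Any as Any using (Any; here; there; any?)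
open import Data.List.Relation.Unary.Any.Properties using (reverse⁺; reverse⁻)
open import Data.Nat.Base using (ℕ; zero; suc; _≤_; _<_; z≤n; s≤s; z<s)
open import Data.Nat.Properties using (≤-antisym; ≤-trans)
open import Data.Product.Base using (∃; ∃₂; _×_; _,_; proj₁; proj₂)
import Data.Product.Properties as Product
open import Data.Sum.Base using (_⊎_; inj₁; inj₂)
open import Data.Vec.Base using ([]; _∷_)
import Data.Vec.Properties as Vec
open import Function.Base using (_∘_)
open import Relation.Binary.Definitions using (DecidableEquality; Symmetric)
open import Relation.Binary.PropositionalEquality
  using (_≡_; _≢_; refl; sym; trans; cong; cong₂; subst)
open import Relation.Nullary.Decidable
  using (Dec; yes; no; does; map′; ¬?; _×-dec_; _⊎-dec_; decidable-stable; from-yes; from-no)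
open import Relation.Nullary.Negation using (¬_; contradiction)
open import Relation.Unary using (Decidable)

private variable
  n k : ℕ
  s   : Outmap n

_≟_ : DecidableEquality (Bits n)
_≟_ = Vec.≡-dec Bool._≟_

-- Trying true first makes the searches below about twice as short.
∃? : {P : Bits n → Set} → Decidable P → Dec (∃ P)
∃? {zero}  P? = map′ ([] ,_) (λ { ([] , p) → p }) (P? [])
∃? {suc n} P? = map′
  (λ { (inj₁ (b , p)) → true ∷ b , p ; (inj₂ (b , p)) → false ∷ b , p })
  (λ { (true ∷ b , p) → inj₁ (b , p) ; (false ∷ b , p) → inj₂ (b , p) })
  (∃? (P? ∘ (true ∷_)) ⊎-dec ∃? (P? ∘ (false ∷_)))

¬∃¬⇒∀ : {P : Bits n → Set} → Decidable P → ¬ ∃ (¬_ ∘ P) → ∀ b → P b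
¬∃¬⇒∀ P? ¬∃¬ b = decidable-stable (P? b) λ ¬p → ¬∃¬ (b , ¬p)

-- Constructive because the search space is finite; it supplies the evader's reply in `evade`.
¬∀⇒∃¬ : {P : Bits n → Set} → Decidable P → ¬ (∀ b → P b) → ∃ (¬_ ∘ P)
¬∀⇒∃¬ P? ¬∀ = decidable-stable (∃? (¬? ∘ P?)) (¬∀ ∘ ¬∃¬⇒∀ P?)

∀? : {P : Bits n → Set} → Decidable P → Dec (∀ b → P b)
∀? P? = map′ (¬∃¬⇒∀ P?) (λ p (b , ¬p) → ¬p (p b)) (¬? (∃? (¬? ∘ P?)))

x⩕[u⊕u]≡𝟎 : (x u : Bits n) → x ⩕ (u ⊕ u) ≡ 𝟎
x⩕[u⊕u]≡𝟎 []      []      = refl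
x⩕[u⊕u]≡𝟎 (a ∷ x) (b ∷ u) =
  cong₂ _∷_ (trans (cong (a ∧_) (Bool.xor-same b)) (Bool.∧-zeroʳ a)) (x⩕[u⊕u]≡𝟎 x u)

⊕-comm : (u v : Bits n) → u ⊕ v ≡ v ⊕ u
⊕-comm = Vec.zipWith-comm Bool.xor-comm

Clash-sym : Symmetric (Clash s)
Clash-sym {s = s} {u} {v} (u≢v , clash) =
  u≢v ∘ sym , trans (cong₂ _⩕_ (⊕-comm (s v) (s u)) (⊕-comm v u)) clash

Answer : ℕ → Set
Answer n = Vertex n × Bits n

History : ℕ → Set
History n = List (Answer n)

Agrees : Outmap n → History n → Set
Agrees s = All λ (u , x) → s u ≡ x

-- Two different answers at the same vertex conflict as well (their vertices
-- have XOR 𝟎), so the evader gains nothing from contradicting itself.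
Conflict : Answer n → Answer n → Set
Conflict p@(u , x) q@(v , y) = p ≢ q × (x ⊕ y) ⩕ (u ⊕ v) ≡ 𝟎

-- Pairs inside `h` are not compared again: each was examined when its later answer was given.
Settles : Answer n → History n → Set
Settles p h = proj₂ p ≡ 𝟎 ⊎ Any (Conflict p) h

-- A win is credited in the very round whose answer settles the game, so an exhausted budget is a
-- loss.
Forced : ℕ → History n → Set
Forced zero    h = ⊥
Forced (suc k) h = ∃ λ v → ∀ x → Settles (v , x) h ⊎ Forced k ((v , x) ∷ h)

conflict? : (p q : Answer n) → Dec (Conflict p q)
conflict? p q = ¬? (Product.≡-dec _≟_ _≟_ p q) ×-dec (_ ≟ _)

settles? : (p : Answer n) (h : History n) → Dec (Settles p h)
settles? p h = (_ ≟ _) ⊎-dec any? (conflict? p) h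

mutual
  forced? : ∀ k (h : History n) → Dec (Forced k h)
  forced? zero    h = no λ ()
  forced? (suc k) h = ∃? λ v → ∀? (reply? k h v)

  reply? : ∀ k (h : History n) v → Decidable λ x → Settles (v , x) h ⊎ Forced k ((v , x) ∷ h)
  reply? k h v x = settles? (v , x) h ⊎-dec forced? k ((v , x) ∷ h)

-- SolvesOn A s is Solved s (queries A s).
Solved : Outmap n → List (Vertex n) → Set
Solved s us = (∃ λ u → u ∈ us × Sink s u) ⊎ (∃₂ λ u v → u ∈ us × v ∈ us × Clash s u v)

Solved-mono : ∀ {us vs} → (∀ {u} → u ∈ us → u ∈ vs) → Solved s us → Solved s vs
Solved-mono f (inj₁ (u , u∈ , sink))           = inj₁ (u , f u∈ , sink)
Solved-mono f (inj₂ (u , v , u∈ , v∈ , clash)) = inj₂ (u , v , f u∈ , f v∈ , clash)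

vertices : History n → List (Vertex n)
vertices = map proj₁

Settles⇒Solved : ∀ {v} {h : History n} → Agrees s h → Settles (v , s v) h → Solved s (v ∷ vertices h)
Settles⇒Solved agr (inj₁ sink) = inj₁ (_ , here refl , sink)
Settles⇒Solved {s = s} {v} agr (inj₂ conf) = let u , u∈ , clash = go agr conf in
  inj₂ (v , u , here refl , there u∈ , clash)
  where
  go : ∀ {h} → Agrees s h → Any (Conflict (v , s v)) h → ∃ λ u → u ∈ vertices h × Clash s v u
  -- Both answers are values of `s`, so distinct answers lie at distinct vertices and the conflict
  -- is a genuine clash.
  go (refl ∷ _)  (here (≢ , ≡𝟎)) = _ , here refl , (λ { refl → ≢ refl }) , ≡𝟎
  go (_    ∷ agr) (there c)       = let u , u∈ , clash = go agr c in u , there u∈ , clash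

strategy : ∀ k (h : History n) → Forced k h → Algorithm n
strategy (suc k) h (v , f) = query v λ x → continue (f x)
  where
  continue : ∀ {x} → Settles (v , x) h ⊎ Forced k ((v , x) ∷ h) → Algorithm _
  continue (inj₁ _) = stop
  continue (inj₂ F) = strategy k _ F

strategy-≤ : ∀ k (h : History n) (F : Forced k h) s → numQueries (strategy k h F) s ≤ k
strategy-≤ (suc k) h (v , f) s with f (s v)
... | inj₁ _ = s≤s z≤n
... | inj₂ F = s≤s (strategy-≤ k _ F s)

-- Histories list the newest answer first, so `ʳ++` restores the order of the run, and moving a
-- query into the history leaves the list definitionally unchanged.
strategy-solves : ∀ k (h : History n) (F : Forced k h) → Agrees s h →
                  Solved s (vertices h ʳ++ queries (strategy k h F) s)
strategy-solves {s = s} (suc k) h (v , f) agr with f (s v)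
... | inj₁ S = Solved-mono reverse⁺ (Settles⇒Solved agr S)
... | inj₂ F = strategy-solves k _ F (refl ∷ agr)

data Unsettled {n} : History n → Set where
  []  : Unsettled []
  _∷_ : ∀ {p h} → ¬ Settles p h → Unsettled h → Unsettled (p ∷ h)

-- A sink, or the later answer of a clashing pair, would have settled the game when it was given.
Unsettled⇒¬Solved : ∀ {h : History n} → Unsettled h → Agrees s h → ¬ Solved s (vertices h)
Unsettled⇒¬Solved {s = s} U agr (inj₁ (_ , u∈ , sink)) = noSink U agr u∈ sink
  where
  noSink : ∀ {h u} → Unsettled h → Agrees s h → u ∈ vertices h → ¬ Sink s u
  noSink (¬S ∷ _) (refl ∷ _)  (here refl) sink = ¬S (inj₁ sink)
  noSink (_ ∷ U)  (_    ∷ agr) (there u∈)  sink = noSink U agr u∈ sink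
Unsettled⇒¬Solved {s = s} U agr (inj₂ (_ , _ , u∈ , v∈ , clash)) = noClash U agr u∈ v∈ clash
  where
  conflict : ∀ {h u v} → Agrees s h → v ∈ vertices h → Clash s u v → Any (Conflict (u , s u)) h
  conflict (refl ∷ _)  (here refl) (u≢v , ≡𝟎) = here (u≢v ∘ cong proj₁ , ≡𝟎)
  conflict (_    ∷ agr) (there v∈)  clash      = there (conflict agr v∈ clash)

  noClash : ∀ {h u v} → Unsettled h → Agrees s h → u ∈ vertices h → v ∈ vertices h → ¬ Clash s u v
  noClash (_ ∷ _)  _            (here refl) (here refl) (u≢u , _) = u≢u refl
  noClash (¬S ∷ _) (refl ∷ agr) (here refl) (there v∈)  clash = ¬S (inj₂ (conflict agr v∈ clash))
  noClash (¬S ∷ _) (refl ∷ agr) (there u∈)  (here refl) clash =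
    ¬S (inj₂ (conflict agr u∈ (Clash-sym {s = s} clash)))
  noClash (_ ∷ U)  (_ ∷ agr)    (there u∈)  (there v∈)  clash = noClash U agr u∈ v∈ clash

-- Unvisited vertices become sinks. This is safe in `evade`, which replays only when the run stops
-- or the budget is spent.
replay : History n → Outmap n
replay []            u = 𝟎
replay ((v , x) ∷ h) u = if does (u ≟ v) then x else replay h u

replay-agrees : ∀ {h : History n} → Unsettled h → Agrees (replay h) h
replay-agrees [] = []
replay-agrees {h = (v , x) ∷ h} (¬S ∷ U) = first ∷ All.tabulate rest
  where
  first : replay ((v , x) ∷ h) v ≡ x
  first with v ≟ v
  ... | yes _   = refl
  ... | no  v≢v = contradiction refl v≢v

  rest : ∀ {p} → p ∈ h → replay ((v , x) ∷ h) (proj₁ p) ≡ proj₂ p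
  rest {u , y} p∈ with u ≟ v
  ... | no  _    = All.lookup (replay-agrees U) p∈
  -- On a repeated vertex the newest answer wins; a different older one would conflict with it,
  -- since `u ⊕ u` vanishes.
  ... | yes refl = decidable-stable (x ≟ y) λ x≢y →
    ¬S (inj₂ (Any.map (λ { refl → x≢y ∘ cong proj₂ , x⩕[u⊕u]≡𝟎 _ u }) p∈))

-- The evader commits to an outmap only at the end. The implication covers algorithms that stop too
-- early: they have not solved `s`.
evade : ∀ k (h : History n) → ¬ Forced k h → Unsettled h → (A : Algorithm n) →
        ∃ λ s → Agrees s h × (Solved s (vertices h ʳ++ queries A s) → k < numQueries A s)
evade k h ¬F U stop = replay h , replay-agrees U , λ solved →
  contradiction (Solved-mono reverse⁻ solved) (Unsettled⇒¬Solved U (replay-agrees U))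
evade zero    h ¬F U (query v κ) = replay h , replay-agrees U , λ _ → z<s
evade (suc k) h ¬F U (query v κ) =
  -- Querying `v` does not force a win, so some answer neither settles the game nor leaves a forced
  -- position.
  let x , ¬reply = ¬∀⇒∃¬ (reply? k h v) (¬F ∘ (v ,_))
      s , agr , slow = evade k ((v , x) ∷ h) (¬reply ∘ inj₂) ((¬reply ∘ inj₁) ∷ U) (κ x)
  -- The recursion followed `κ x`, while the run on `s` follows `κ (s v)`.
  in s , All.tail agr , subst
       (λ y → Solved s (vertices h ʳ++ (v ∷ queries (κ y) s)) → suc k < suc (numQueries (κ y) s))
       (sym (All.head agr)) (s≤s ∘ slow)

¬Forced⇒slow : ¬ Forced {n} k [] → (A : Algorithm n) → SolvesSinkOrClash A →
               ∃ λ s → k < numQueries A s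
¬Forced⇒slow ¬F A solves =
  let s , _ , slow = evade _ [] ¬F [] A in s , slow (solves s)

t-characterisation : Forced {n} (suc k) [] → ¬ Forced {n} k [] → t[ n ]≡ suc k
t-characterisation {n} {k} F ¬F =
  (A , solves , attained , λ { _ (s , refl) → strategy-≤ _ [] F s }) , minimal
  where
  A : Algorithm n
  A = strategy _ [] F

  solves : SolvesSinkOrClash A
  solves s = strategy-solves _ [] F []

  attained : ∃ λ s → numQueries A s ≡ suc k
  -- The lower bound, applied to `A` itself, shows that its budget is used up on some outmap.
  attained = let s , slow = ¬Forced⇒slow ¬F A solves in s , ≤-antisym (strategy-≤ _ [] F s) slow

  minimal : ∀ m → (∃ λ B → SolvesSinkOrClash B × IsWorstCase B m) → suc k ≤ m
  minimal m (B , solvesB , _ , max) =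
    let s , slow = ¬Forced⇒slow ¬F B solvesB in ≤-trans slow (max _ (s , refl))

forced₅ : Forced {3} 5 []
forced₅ = from-yes (forced? {3} 5 [])

¬forced₄ : ¬ Forced {3} 4 []
¬forced₄ = from-no (forced? {3} 4 [])

lemma24 : t[ 3 ]≡ 5
lemma24 = t-characterisation forced₅ ¬forced₄
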